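{- Every typed term (of any of the three kinds: $c$-term, $l$-term, $r$-term) of the simply typed $\overline{\lambda}\mu\tilde{\mu}$-calculus is strongly normalizing for the $l$-reduction $\triangleright_l$, i.e. there is no infinite sequence of $\triangleright_l$-steps starting from it.
   Context: Syntax of the $\overline{\lambda}\mu\tilde{\mu}$-calculus. There are $l$-variables $x,y,\dots$ and $r$-variables $\alpha,\beta,\dots$, and three kinds of terms: $c ::= \langle t_l,t_r\rangle$ ($c$-terms); $t_l ::= x \mid \lambda x\, t_l \mid \mu\alpha\, c \mid t_r.t_l$ ($l$-terms); $t_r ::= \alpha \mid \lambda\alpha\, t_r \mid \mu x\, c \mid t_l.t_r$ ($r$-terms). The constructors $\lambda x,\lambda\alpha,\mu x,\mu\alpha$ bind their variable; terms are considered up to renaming of bound variables and substitution is capture-avoiding. Types are built from atomic formulas with the binary connectives $\rightarrow$ and $-$. An $l$-context $\Gamma$ is a set of declarations $x:A$; an $r$-context $\Delta$ is a set of declarations $\alpha:A$. Judgments are of the forms $c:(\Gamma\vdash\Delta)$, $\Gamma\vdash [t_l:A],\Delta$ and $\Gamma,[t_r:A]\vdash\Delta$ (the bracketed formula is the distinguished one). Typing rules: - $\Gamma,x:A\vdash[x:A],\Delta$ and $\Gamma,[\alpha:A]\vdash\alpha:A,\Delta$ (axioms); - from $\Gamma,x:A\vdash[t_l:B],\Delta$ infer $\Gamma\vdash[\lambda x\,t_l:A\rightarrow B],\Delta$; - from $\Gamma\vdash[t_l:A],\Delta$ and $\Gamma,[t_r:B]\vdash\Delta$ infer $\Gamma,[t_l.t_r:A\rightarrow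 B]\vdash\Delta$; - from $\Gamma\vdash[t_l:A],\Delta$ and $\Gamma,[t_r:B]\vdash\Delta$ infer $\Gamma\vdash[t_r.t_l:A-B],\Delta$; - from $\Gamma,[t_r:A]\vdash\alpha:B,\Delta$ infer $\Gamma,[\lambda\alpha\,t_r:A-B]\vdash\Delta$; - from $\Gamma\vdash[t_l:A],\Delta$ and $\Gamma,[t_r:A]\vdash\Delta$ infer $\langle t_l,t_r\rangle:(\Gamma\vdash\Delta)$; - from $c:(\Gamma\vdash\alpha:A,\Delta)$ infer $\Gamma\vdash[\mu\alpha\,c:A],\Delta$; - from $c:(\Gamma,x:A\vdash\Delta)$ infer $\Gamma,[\mu x\,c:A]\vdash\Delta$. A term is typed if it occurs as subject of a derivable judgment. The $l$-reduction $\triangleright_l$ is the closure under all term constructors of the rules (bound variables being renamed to avoid capture): - $\langle\lambda x\,t_l,\,t'_l.t_r\rangle\triangleright_{\lambda}\langle t'_l,\,\mu x\,\langle t_l,t_r\rangle\rangle$; - $\langle t'_r.t_l,\,\lambda\alpha\,t_r\rangle\triangleright_{\overline{\lambda}}\langle\mu\alpha\,\langle t_l,t_r\rangle,\,t'_r\rangle$; - $\langle\mu\alpha\,c,\,t_r\rangle\triangleright_{\mu}c[\alpha:=t_r]$; - $\langle t_l,\,\mu x\,c\rangle\triangleright_{\tilde\mu}c[x:=t_l]$. -}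

module Defs where

open import Data.Fin.Base using (Fin; zero; suc; lift)
open import Data.Nat.Base using (ℕ; zero; suc)
open import Data.Product.Base using (∃-syntax; Σ-syntax)
open import Data.Vec.Base using (Vec; _∷_; lookup)
open import Function.Base using (_∘_; id; flip)
open import Induction.InfiniteDescent using (InfiniteDescendingSequenceFrom)
open import Level using (Level)
open import Relation.Binary.PropositionalEquality.Core using (_≡_)
open import Relation.Nullary.Negation.Core using (¬_)

infix  8 _∙ˡ_ _∙ʳ_
infix  8 _⇒_ _-_
infix  4 _▷_
infix  4 _∶⟨_⊢_⟩ _⊢[_∶_],_ _,[_∶_]⊢_

data Kind : Set where
  c l r : Kind

private
  variable
    a         : Level
    k         : Kind
    m n m′ n′ : ℕ

-- Well-scoped de Bruijn terms, so that equality of terms is equality up to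
-- renaming of bound variables.  `Term k m n` is the set of k-terms with free
-- l-variables among m given ones and free r-variables among n given ones;
-- the two sorts of variables are indexed independently, and a binder
-- captures index zero of its own sort.  The superscript of a constructor is
-- the kind of the term it builds:
--   t_r . t_l  (an l-term)  is  e ∙ˡ t,
--   t_l . t_r  (an r-term)  is  t ∙ʳ e.
data Term : Kind → ℕ → ℕ → Set where
  ⟨_,_⟩ : Term l m n → Term r m n → Term c m n

  varˡ  : Fin m → Term l m n
  λˡ    : Term l (suc m) n → Term l m n
  μˡ    : Term c m (suc n) → Term l m n
  _∙ˡ_  : Term r m n → Term l m n → Term l m n

  varʳ  : Fin n → Term r m n
  λʳ    : Term r m (suc n) → Term r m n
  μʳ    : Term c (suc m) n → Term r m n
  _∙ʳ_  : Term l m n → Term r m n → Term r m n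

rename : (Fin m → Fin m′) → (Fin n → Fin n′) → Term k m n → Term k m′ n′
rename ρ ξ ⟨ t , e ⟩ = ⟨ rename ρ ξ t , rename ρ ξ e ⟩
rename ρ ξ (varˡ x)  = varˡ (ρ x)
rename ρ ξ (λˡ t)    = λˡ (rename (lift 1 ρ) ξ t)
rename ρ ξ (μˡ s)    = μˡ (rename ρ (lift 1 ξ) s)
rename ρ ξ (e ∙ˡ t)  = rename ρ ξ e ∙ˡ rename ρ ξ t
rename ρ ξ (varʳ α)  = varʳ (ξ α)
rename ρ ξ (λʳ e)    = λʳ (rename ρ (lift 1 ξ) e)
rename ρ ξ (μʳ s)    = μʳ (rename (lift 1 ρ) ξ s)
rename ρ ξ (t ∙ʳ e)  = rename ρ ξ t ∙ʳ rename ρ ξ e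

weakenˡ : Term k m n → Term k (suc m) n
weakenˡ = rename suc id

weakenʳ : Term k m n → Term k m (suc n)
weakenʳ = rename id suc

liftˡ : (Fin m → Term l m′ n′) → Fin (suc m) → Term l (suc m′) n′
liftˡ σ zero    = varˡ zero
liftˡ σ (suc x) = weakenˡ (σ x)

liftʳ : (Fin n → Term r m′ n′) → Fin (suc n) → Term r m′ (suc n′)
liftʳ τ zero    = varʳ zero
liftʳ τ (suc α) = weakenʳ (τ α)

-- Simultaneous substitution of l-terms for the l-variables and of r-terms
-- for the r-variables.
subst : (Fin m → Term l m′ n′) → (Fin n → Term r m′ n′) →
        Term k m n → Term k m′ n′
subst σ τ ⟨ t , e ⟩ = ⟨ subst σ τ t , subst σ τ e ⟩
subst σ τ (varˡ x)  = σ x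
subst σ τ (λˡ t)    = λˡ (subst (liftˡ σ) (weakenˡ ∘ τ) t)
subst σ τ (μˡ s)    = μˡ (subst (weakenʳ ∘ σ) (liftʳ τ) s)
subst σ τ (e ∙ˡ t)  = subst σ τ e ∙ˡ subst σ τ t
subst σ τ (varʳ α)  = τ α
subst σ τ (λʳ e)    = λʳ (subst (weakenʳ ∘ σ) (liftʳ τ) e)
subst σ τ (μʳ s)    = μʳ (subst (liftˡ σ) (weakenˡ ∘ τ) s)
subst σ τ (t ∙ʳ e)  = subst σ τ t ∙ʳ subst σ τ e

singleˡ : Term l m n → Fin (suc m) → Term l m n
singleˡ t zero    = t
singleˡ t (suc x) = varˡ x

singleʳ : Term r m n → Fin (suc n) → Term r m n
singleʳ e zero    = e
singleʳ e (suc α) = varʳ α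

-- s [ t ]ˡ is s[x := t] and s [ e ]ʳ is s[α := e], where x (resp. α) is
-- index zero of s.
_[_]ˡ : Term k (suc m) n → Term l m n → Term k m n
s [ t ]ˡ = subst (singleˡ t) varʳ s

_[_]ʳ : Term k m (suc n) → Term r m n → Term k m n
s [ e ]ʳ = subst varˡ (singleʳ e) s

data Type (Atom : Set a) : Set a where
  atom    : Atom → Type Atom
  _⇒_ _-_ : Type Atom → Type Atom → Type Atom

-- A context gives one type to each variable in scope; it serves both as
-- l-context and as r-context.
Context : Set a → ℕ → Set a
Context Atom = Vec (Type Atom)

mutual
  data _∶⟨_⊢_⟩ {Atom : Set a} {m n} :
       Term c m n → Context Atom m → Context Atom n → Set a where
    cut   : ∀ {Γ Δ A t e} →
            Γ ⊢[ t ∶ A ], Δ → Γ ,[ e ∶ A ]⊢ Δ → ⟨ t , e ⟩ ∶⟨ Γ ⊢ Δ ⟩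

  data _⊢[_∶_],_ {Atom : Set a} {m n} :
       Context Atom m → Term l m n → Type Atom → Context Atom n → Set a where
    axˡ   : ∀ {Γ Δ A x} →
            lookup Γ x ≡ A → Γ ⊢[ varˡ x ∶ A ], Δ
    ⇒-r   : ∀ {Γ Δ A B t} →
            (A ∷ Γ) ⊢[ t ∶ B ], Δ → Γ ⊢[ λˡ t ∶ A ⇒ B ], Δ
    minus-r : ∀ {Γ Δ A B t e} →
            Γ ⊢[ t ∶ A ], Δ → Γ ,[ e ∶ B ]⊢ Δ → Γ ⊢[ e ∙ˡ t ∶ A - B ], Δ
    act-r : ∀ {Γ Δ A s} →
            s ∶⟨ Γ ⊢ A ∷ Δ ⟩ → Γ ⊢[ μˡ s ∶ A ], Δ

  data _,[_∶_]⊢_ {Atom : Set a} {m n} :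
       Context Atom m → Term r m n → Type Atom → Context Atom n → Set a where
    axʳ   : ∀ {Γ Δ A α} →
            lookup Δ α ≡ A → Γ ,[ varʳ α ∶ A ]⊢ Δ
    ⇒-l   : ∀ {Γ Δ A B t e} →
            Γ ⊢[ t ∶ A ], Δ → Γ ,[ e ∶ B ]⊢ Δ → Γ ,[ t ∙ʳ e ∶ A ⇒ B ]⊢ Δ
    minus-l : ∀ {Γ Δ A B e} →
            Γ ,[ e ∶ A ]⊢ (B ∷ Δ) → Γ ,[ λʳ e ∶ A - B ]⊢ Δ
    act-l : ∀ {Γ Δ A s} →
            s ∶⟨ A ∷ Γ ⊢ Δ ⟩ → Γ ,[ μʳ s ∶ A ]⊢ Δ

Typed : (Atom : Set a) → Term k m n → Set a
Typed {k = c} {m} {n} Atom s =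
  Σ[ Γ ∈ Context Atom m ] Σ[ Δ ∈ Context Atom n ]
    s ∶⟨ Γ ⊢ Δ ⟩
Typed {k = l} {m} {n} Atom t =
  Σ[ Γ ∈ Context Atom m ] Σ[ A ∈ Type Atom ] Σ[ Δ ∈ Context Atom n ]
    Γ ⊢[ t ∶ A ], Δ
Typed {k = r} {m} {n} Atom e =
  Σ[ Γ ∈ Context Atom m ] Σ[ A ∈ Type Atom ] Σ[ Δ ∈ Context Atom n ]
    Γ ,[ e ∶ A ]⊢ Δ

data _▷_ : Term k m n → Term k m n → Set where
  -- Moving e (resp. t) under the new binder renames bound variables apart,
  -- i.e. weakens it.
  ▷λ  : {t : Term l (suc m) n} {t′ : Term l m n} {e : Term r m n} →
        ⟨ λˡ t , t′ ∙ʳ e ⟩ ▷ ⟨ t′ , μʳ ⟨ t , weakenˡ e ⟩ ⟩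
  ▷λ̄  : {e′ : Term r m n} {t : Term l m n} {e : Term r m (suc n)} →
        ⟨ e′ ∙ˡ t , λʳ e ⟩ ▷ ⟨ μˡ ⟨ weakenʳ t , e ⟩ , e′ ⟩
  ▷μ  : {s : Term c m (suc n)} {e : Term r m n} →
        ⟨ μˡ s , e ⟩ ▷ s [ e ]ʳ
  ▷μ̃  : {t : Term l m n} {s : Term c (suc m) n} →
        ⟨ t , μʳ s ⟩ ▷ s [ t ]ˡ

  ξ-cutˡ : {t t′ : Term l m n} {e : Term r m n} →
           t ▷ t′ → ⟨ t , e ⟩ ▷ ⟨ t′ , e ⟩
  ξ-cutʳ : {t : Term l m n} {e e′ : Term r m n} →
           e ▷ e′ → ⟨ t , e ⟩ ▷ ⟨ t , e′ ⟩
  ξ-λˡ   : {t t′ : Term l (suc m) n} →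
           t ▷ t′ → λˡ t ▷ λˡ t′
  ξ-μˡ   : {s s′ : Term c m (suc n)} →
           s ▷ s′ → μˡ s ▷ μˡ s′
  ξ-∙ˡ₁  : {e e′ : Term r m n} {t : Term l m n} →
           e ▷ e′ → e ∙ˡ t ▷ e′ ∙ˡ t
  ξ-∙ˡ₂  : {e : Term r m n} {t t′ : Term l m n} →
           t ▷ t′ → e ∙ˡ t ▷ e ∙ˡ t′
  ξ-λʳ   : {e e′ : Term r m (suc n)} →
           e ▷ e′ → λʳ e ▷ λʳ e′
  ξ-μʳ   : {s s′ : Term c (suc m) n} →
           s ▷ s′ → μʳ s ▷ μʳ s′
  ξ-∙ʳ₁  : {t t′ : Term l m n} {e : Term r m n} →
           t ▷ t′ → t ∙ʳ e ▷ t′ ∙ʳ e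
  ξ-∙ʳ₂  : {t : Term l m n} {e e′ : Term r m n} →
           e ▷ e′ → t ∙ʳ e ▷ t ∙ʳ e′

-- The library's sequences descend, so an infinite reduction
-- t = f 0 ▷ f 1 ▷ … is an infinite descending sequence for flip _▷_.
StronglyNormalizing : Term k m n → Set
StronglyNormalizing t = ¬ (∃[ f ] InfiniteDescendingSequenceFrom (flip _▷_) f t)

{-# OPTIONS --safe #-}
module Submission where

-- Say u ≺ t when u is a reduct or an immediate subterm of t; below a strongly
-- normalizing term, ≺ is well founded.  By induction on the type A, the cut of
-- strongly normalizing t and e of type A is strongly normalizing: contracting a
-- λ-redex leaves cuts at the components of A, so only the mutual substitutions
-- caused by μ and μ̃ matter.  These are controlled by a predicate defined by
-- recursion on ≺: an r-term X of type A is good for t if ⟨ u[τ] , X ⟩ is strongly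
-- normalizing for all u ≺ t and all τ replacing r-variables of type A by terms
-- good for u.  Such τ preserve strong normalization of t (the reducts of t being
-- below t), and a simultaneous induction on (t , e) shows that e[σ] is good for t
-- and t[τ] good for e: ⟨ μα s , X ⟩ contracts to s[α := X], where s ≺ μα s.

open import Defs
open import Data.Fin.Base using (Fin; zero; suc; lift)
open import Data.Nat.Base using (ℕ; suc)
open import Data.Product.Base using (_×_; _,_; ∃-syntax)
open import Data.Sum.Base using (_⊎_; inj₁; inj₂)
open import Data.Unit.Base using (⊤; tt)
open import Data.Unit.Polymorphic.Base using () renaming (⊤ to ⊤ₚ; tt to ttₚ)
open import Data.Vec.Base using (_∷_; lookup)
open import Data.Vec.Functional using () renaming (_∷_ to _∷ᶠ_)
open import Function.Base using (_∘_; id; flip)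
open import Induction.InfiniteDescent using (InfiniteDescendingSequenceFrom; descent∧acc⇒unsatisfiable)
open import Induction.WellFounded using (Acc; acc; acc-inverse)
open import Level using (Level)
open import Relation.Binary.Construct.Closure.ReflexiveTransitive using (Star; ε; _◅_; _◅◅_; gmap)
open import Relation.Binary.PropositionalEquality as ≡ using (_≡_; refl; sym; trans; cong; cong₂)

variable
  a : Level
  j k : Kind
  m n m′ n′ m″ n″ : ℕ
  ρ ρ₁ ρ₂ : Fin m → Fin m′
  ξ ξ₁ ξ₂ : Fin n → Fin n′
  σ σ₁ σ₂ : Fin m → Term l m′ n′
  τ τ₁ τ₂ : Fin n → Term r m′ n′

-- Renaming and substitution

lift-∘ : (∀ x → ρ₂ (ρ₁ x) ≡ ρ x) → ∀ x → lift 1 ρ₂ (lift 1 ρ₁ x) ≡ lift 1 ρ x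
lift-∘ h zero    = refl
lift-∘ h (suc x) = cong suc (h x)

-- The composite is a separate parameter constrained pointwise: under a binder, the lifted maps
-- agree with the lifted composite only pointwise, and in this form the induction needs no function
-- extensionality. The later fusion laws share this form.
rename-rename : (∀ x → ρ₂ (ρ₁ x) ≡ ρ x) → (∀ α → ξ₂ (ξ₁ α) ≡ ξ α) →
                (t : Term k m n) → rename ρ₂ ξ₂ (rename ρ₁ ξ₁ t) ≡ rename ρ ξ t
rename-rename f g ⟨ t , e ⟩ = cong₂ ⟨_,_⟩ (rename-rename f g t) (rename-rename f g e)
rename-rename f g (varˡ x)  = cong varˡ (f x)
rename-rename f g (λˡ t)    = cong λˡ (rename-rename (lift-∘ f) g t)
rename-rename f g (μˡ s)    = cong μˡ (rename-rename f (lift-∘ g) s)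
rename-rename f g (e ∙ˡ t)  = cong₂ _∙ˡ_ (rename-rename f g e) (rename-rename f g t)
rename-rename f g (varʳ α)  = cong varʳ (g α)
rename-rename f g (λʳ e)    = cong λʳ (rename-rename f (lift-∘ g) e)
rename-rename f g (μʳ s)    = cong μʳ (rename-rename (lift-∘ f) g s)
rename-rename f g (t ∙ʳ e)  = cong₂ _∙ʳ_ (rename-rename f g t) (rename-rename f g e)

rename-weakenˡ : (t : Term k m n) →
                 rename (lift 1 ρ) ξ (weakenˡ t) ≡ weakenˡ (rename ρ ξ t)
rename-weakenˡ t = trans (rename-rename (λ _ → refl) (λ _ → refl) t)
                         (sym (rename-rename (λ _ → refl) (λ _ → refl) t))

rename-weakenʳ : (t : Term k m n) →
                 rename ρ (lift 1 ξ) (weakenʳ t) ≡ weakenʳ (rename ρ ξ t)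
rename-weakenʳ t = trans (rename-rename (λ _ → refl) (λ _ → refl) t)
                         (sym (rename-rename (λ _ → refl) (λ _ → refl) t))

liftˡ-lift : (∀ x → σ₁ (ρ x) ≡ σ x) → ∀ x → liftˡ σ₁ (lift 1 ρ x) ≡ liftˡ σ x
liftˡ-lift h zero    = refl
liftˡ-lift h (suc x) = cong weakenˡ (h x)

liftʳ-lift : (∀ α → τ₁ (ξ α) ≡ τ α) → ∀ α → liftʳ τ₁ (lift 1 ξ α) ≡ liftʳ τ α
liftʳ-lift h zero    = refl
liftʳ-lift h (suc α) = cong weakenʳ (h α)

subst-rename : (∀ x → σ₁ (ρ x) ≡ σ x) → (∀ α → τ₁ (ξ α) ≡ τ α) →
               (t : Term k m n) → subst σ₁ τ₁ (rename ρ ξ t) ≡ subst σ τ t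
subst-rename f g ⟨ t , e ⟩ = cong₂ ⟨_,_⟩ (subst-rename f g t) (subst-rename f g e)
subst-rename f g (varˡ x)  = f x
subst-rename f g (λˡ t)    = cong λˡ (subst-rename (liftˡ-lift f) (cong weakenˡ ∘ g) t)
subst-rename f g (μˡ s)    = cong μˡ (subst-rename (cong weakenʳ ∘ f) (liftʳ-lift g) s)
subst-rename f g (e ∙ˡ t)  = cong₂ _∙ˡ_ (subst-rename f g e) (subst-rename f g t)
subst-rename f g (varʳ α)  = g α
subst-rename f g (λʳ e)    = cong λʳ (subst-rename (cong weakenʳ ∘ f) (liftʳ-lift g) e)
subst-rename f g (μʳ s)    = cong μʳ (subst-rename (liftˡ-lift f) (cong weakenˡ ∘ g) s)
subst-rename f g (t ∙ʳ e)  = cong₂ _∙ʳ_ (subst-rename f g t) (subst-rename f g e)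

rename-liftˡ : (∀ x → rename ρ ξ (σ₁ x) ≡ σ x) →
               ∀ x → rename (lift 1 ρ) ξ (liftˡ σ₁ x) ≡ liftˡ σ x
rename-liftˡ h zero    = refl
rename-liftˡ {σ₁ = σ₁} h (suc x) = trans (rename-weakenˡ (σ₁ x)) (cong weakenˡ (h x))

rename-liftʳ : (∀ α → rename ρ ξ (τ₁ α) ≡ τ α) →
               ∀ α → rename ρ (lift 1 ξ) (liftʳ τ₁ α) ≡ liftʳ τ α
rename-liftʳ h zero    = refl
rename-liftʳ {τ₁ = τ₁} h (suc α) = trans (rename-weakenʳ (τ₁ α)) (cong weakenʳ (h α))

rename-subst : (∀ x → rename ρ ξ (σ₁ x) ≡ σ x) → (∀ α → rename ρ ξ (τ₁ α) ≡ τ α) →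
               (t : Term k m n) → rename ρ ξ (subst σ₁ τ₁ t) ≡ subst σ τ t
rename-subst f g ⟨ t , e ⟩ = cong₂ ⟨_,_⟩ (rename-subst f g t) (rename-subst f g e)
rename-subst f g (varˡ x)  = f x
rename-subst {τ₁ = τ₁} f g (λˡ t) =
  cong λˡ (rename-subst (rename-liftˡ f) (λ α → trans (rename-weakenˡ (τ₁ α)) (cong weakenˡ (g α))) t)
rename-subst {σ₁ = σ₁} f g (μˡ s) =
  cong μˡ (rename-subst (λ x → trans (rename-weakenʳ (σ₁ x)) (cong weakenʳ (f x))) (rename-liftʳ g) s)
rename-subst f g (e ∙ˡ t)  = cong₂ _∙ˡ_ (rename-subst f g e) (rename-subst f g t)
rename-subst f g (varʳ α)  = g α
rename-subst {σ₁ = σ₁} f g (λʳ e) =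
  cong λʳ (rename-subst (λ x → trans (rename-weakenʳ (σ₁ x)) (cong weakenʳ (f x))) (rename-liftʳ g) e)
rename-subst {τ₁ = τ₁} f g (μʳ s) =
  cong μʳ (rename-subst (rename-liftˡ f) (λ α → trans (rename-weakenˡ (τ₁ α)) (cong weakenˡ (g α))) s)
rename-subst f g (t ∙ʳ e)  = cong₂ _∙ʳ_ (rename-subst f g t) (rename-subst f g e)

subst-weakenˡ : (t : Term k m n) →
                subst (liftˡ σ) (weakenˡ ∘ τ) (weakenˡ t) ≡ weakenˡ (subst σ τ t)
subst-weakenˡ t = trans (subst-rename (λ _ → refl) (λ _ → refl) t)
                        (sym (rename-subst (λ _ → refl) (λ _ → refl) t))

subst-weakenʳ : (t : Term k m n) →
                subst (weakenʳ ∘ σ) (liftʳ τ) (weakenʳ t) ≡ weakenʳ (subst σ τ t)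
subst-weakenʳ t = trans (subst-rename (λ _ → refl) (λ _ → refl) t)
                        (sym (rename-subst (λ _ → refl) (λ _ → refl) t))

subst-liftˡ : (∀ x → subst σ₂ τ₂ (σ₁ x) ≡ σ x) →
              ∀ x → subst (liftˡ σ₂) (weakenˡ ∘ τ₂) (liftˡ σ₁ x) ≡ liftˡ σ x
subst-liftˡ h zero    = refl
subst-liftˡ {σ₁ = σ₁} h (suc x) = trans (subst-weakenˡ (σ₁ x)) (cong weakenˡ (h x))

subst-liftʳ : (∀ α → subst σ₂ τ₂ (τ₁ α) ≡ τ α) →
              ∀ α → subst (weakenʳ ∘ σ₂) (liftʳ τ₂) (liftʳ τ₁ α) ≡ liftʳ τ α
subst-liftʳ h zero    = refl
subst-liftʳ {τ₁ = τ₁} h (suc α) = trans (subst-weakenʳ (τ₁ α)) (cong weakenʳ (h α))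

subst-subst : (∀ x → subst σ₂ τ₂ (σ₁ x) ≡ σ x) → (∀ α → subst σ₂ τ₂ (τ₁ α) ≡ τ α) →
              (t : Term k m n) → subst σ₂ τ₂ (subst σ₁ τ₁ t) ≡ subst σ τ t
subst-subst f g ⟨ t , e ⟩ = cong₂ ⟨_,_⟩ (subst-subst f g t) (subst-subst f g e)
subst-subst f g (varˡ x)  = f x
subst-subst {τ₁ = τ₁} f g (λˡ t) =
  cong λˡ (subst-subst (subst-liftˡ f) (λ α → trans (subst-weakenˡ (τ₁ α)) (cong weakenˡ (g α))) t)
subst-subst {σ₁ = σ₁} f g (μˡ s) =
  cong μˡ (subst-subst (λ x → trans (subst-weakenʳ (σ₁ x)) (cong weakenʳ (f x))) (subst-liftʳ g) s)
subst-subst f g (e ∙ˡ t)  = cong₂ _∙ˡ_ (subst-subst f g e) (subst-subst f g t)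
subst-subst f g (varʳ α)  = g α
subst-subst {σ₁ = σ₁} f g (λʳ e) =
  cong λʳ (subst-subst (λ x → trans (subst-weakenʳ (σ₁ x)) (cong weakenʳ (f x))) (subst-liftʳ g) e)
subst-subst {τ₁ = τ₁} f g (μʳ s) =
  cong μʳ (subst-subst (subst-liftˡ f) (λ α → trans (subst-weakenˡ (τ₁ α)) (cong weakenˡ (g α))) s)
subst-subst f g (t ∙ʳ e)  = cong₂ _∙ʳ_ (subst-subst f g t) (subst-subst f g e)

liftˡ-var : (∀ x → σ x ≡ varˡ x) → ∀ x → liftˡ σ x ≡ varˡ x
liftˡ-var h zero    = refl
liftˡ-var h (suc x) = cong weakenˡ (h x)

liftʳ-var : (∀ α → τ α ≡ varʳ α) → ∀ α → liftʳ τ α ≡ varʳ α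
liftʳ-var h zero    = refl
liftʳ-var h (suc α) = cong weakenʳ (h α)

subst-id : (∀ x → σ x ≡ varˡ x) → (∀ α → τ α ≡ varʳ α) →
           (t : Term k m n) → subst σ τ t ≡ t
subst-id f g ⟨ t , e ⟩ = cong₂ ⟨_,_⟩ (subst-id f g t) (subst-id f g e)
subst-id f g (varˡ x)  = f x
subst-id f g (λˡ t)    = cong λˡ (subst-id (liftˡ-var f) (cong weakenˡ ∘ g) t)
subst-id f g (μˡ s)    = cong μˡ (subst-id (cong weakenʳ ∘ f) (liftʳ-var g) s)
subst-id f g (e ∙ˡ t)  = cong₂ _∙ˡ_ (subst-id f g e) (subst-id f g t)
subst-id f g (varʳ α)  = g α
subst-id f g (λʳ e)    = cong λʳ (subst-id (cong weakenʳ ∘ f) (liftʳ-var g) e)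
subst-id f g (μʳ s)    = cong μʳ (subst-id (liftˡ-var f) (cong weakenˡ ∘ g) s)
subst-id f g (t ∙ʳ e)  = cong₂ _∙ʳ_ (subst-id f g t) (subst-id f g e)

rename-as-subst : (t : Term k m n) → rename ρ ξ t ≡ subst (varˡ ∘ ρ) (varʳ ∘ ξ) t
rename-as-subst t = trans (cong (rename _ _) (sym (subst-id (λ _ → refl) (λ _ → refl) t)))
                          (rename-subst (λ _ → refl) (λ _ → refl) t)

rename-id : (t : Term k m n) → rename id id t ≡ t
rename-id t = trans (rename-as-subst t) (subst-id (λ _ → refl) (λ _ → refl) t)

subst-[]ˡ : (s : Term k (suc m) n) (t : Term l m n) →
            subst σ τ (s [ t ]ˡ) ≡ subst (subst σ τ t ∷ᶠ σ) τ s
subst-[]ˡ s t = subst-subst (λ { zero → refl ; (suc x) → refl }) (λ _ → refl) s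

subst-[]ʳ : (s : Term k m (suc n)) (e : Term r m n) →
            subst σ τ (s [ e ]ʳ) ≡ subst σ (subst σ τ e ∷ᶠ τ) s
subst-[]ʳ s e = subst-subst (λ _ → refl) (λ { zero → refl ; (suc α) → refl }) s

weaken-[]ˡ : (u : Term k m n) (t : Term l m n) → weakenˡ u [ t ]ˡ ≡ u
weaken-[]ˡ u t = trans (subst-rename (λ _ → refl) (λ _ → refl) u) (subst-id (λ _ → refl) (λ _ → refl) u)

weaken-[]ʳ : (u : Term k m n) (e : Term r m n) → weakenʳ u [ e ]ʳ ≡ u
weaken-[]ʳ u e = trans (subst-rename (λ _ → refl) (λ _ → refl) u) (subst-id (λ _ → refl) (λ _ → refl) u)

-- Contracting after substituting merges the contracted term into the simultaneous substitution.
-- This is how the contracta of `▷μ` and `▷μ̃` become terms under an extended environment.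
lift-[]ˡ : (s : Term k (suc m) n) (t : Term l m′ n′) →
           subst (liftˡ σ) (weakenˡ ∘ τ) s [ t ]ˡ ≡ subst (t ∷ᶠ σ) τ s
lift-[]ˡ s t = subst-subst (λ { zero → refl ; (suc x) → weaken-[]ˡ _ t }) (λ α → weaken-[]ˡ _ t) s

lift-[]ʳ : (s : Term k m (suc n)) (e : Term r m′ n′) →
           subst (weakenʳ ∘ σ) (liftʳ τ) s [ e ]ʳ ≡ subst σ (e ∷ᶠ τ) s
lift-[]ʳ s e = subst-subst (λ x → weaken-[]ʳ _ e) (λ { zero → refl ; (suc α) → weaken-[]ʳ _ e }) s

rename-[]ˡ : (s : Term k (suc m) n) (t : Term l m n) →
             rename ρ ξ (s [ t ]ˡ) ≡ rename (lift 1 ρ) ξ s [ rename ρ ξ t ]ˡ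
rename-[]ˡ {ρ = ρ} {ξ = ξ} s t =
  trans (rename-subst {σ = rename ρ ξ t ∷ᶠ (varˡ ∘ ρ)} (λ { zero → refl ; (suc x) → refl }) (λ _ → refl) s)
        (sym (subst-rename (λ { zero → refl ; (suc x) → refl }) (λ _ → refl) s))

rename-[]ʳ : (s : Term k m (suc n)) (e : Term r m n) →
             rename ρ ξ (s [ e ]ʳ) ≡ rename ρ (lift 1 ξ) s [ rename ρ ξ e ]ʳ
rename-[]ʳ {ρ = ρ} {ξ = ξ} s e =
  trans (rename-subst {τ = rename ρ ξ e ∷ᶠ (varʳ ∘ ξ)} (λ _ → refl) (λ { zero → refl ; (suc α) → refl }) s)
        (sym (subst-rename (λ _ → refl) (λ { zero → refl ; (suc α) → refl }) s))

-- Reduction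

▷-respʳ-≡ : {t u v : Term k m n} → u ≡ v → t ▷ u → t ▷ v
▷-respʳ-≡ refl p = p

▷-subst : {t t′ : Term k m n} → t ▷ t′ → subst σ τ t ▷ subst σ τ t′
▷-subst (▷λ {e = e})         = ▷-respʳ-≡ (cong (λ e′ → ⟨ _ , μʳ ⟨ _ , e′ ⟩ ⟩) (sym (subst-weakenˡ e))) ▷λ
▷-subst (▷λ̄ {t = t})         = ▷-respʳ-≡ (cong (λ t′ → ⟨ μˡ ⟨ t′ , _ ⟩ , _ ⟩) (sym (subst-weakenʳ t))) ▷λ̄
▷-subst (▷μ {s = s} {e = e}) = ▷-respʳ-≡ (trans (lift-[]ʳ s (subst _ _ e)) (sym (subst-[]ʳ s e))) ▷μ
▷-subst (▷μ̃ {t = t} {s = s}) = ▷-respʳ-≡ (trans (lift-[]ˡ s (subst _ _ t)) (sym (subst-[]ˡ s t))) ▷μ̃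
▷-subst (ξ-cutˡ p) = ξ-cutˡ (▷-subst p)
▷-subst (ξ-cutʳ p) = ξ-cutʳ (▷-subst p)
▷-subst (ξ-λˡ p)   = ξ-λˡ (▷-subst p)
▷-subst (ξ-μˡ p)   = ξ-μˡ (▷-subst p)
▷-subst (ξ-∙ˡ₁ p)  = ξ-∙ˡ₁ (▷-subst p)
▷-subst (ξ-∙ˡ₂ p)  = ξ-∙ˡ₂ (▷-subst p)
▷-subst (ξ-λʳ p)   = ξ-λʳ (▷-subst p)
▷-subst (ξ-μʳ p)   = ξ-μʳ (▷-subst p)
▷-subst (ξ-∙ʳ₁ p)  = ξ-∙ʳ₁ (▷-subst p)
▷-subst (ξ-∙ʳ₂ p)  = ξ-∙ʳ₂ (▷-subst p)

▷-rename : {t t′ : Term k m n} → t ▷ t′ → rename ρ ξ t ▷ rename ρ ξ t′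
▷-rename p = ≡.subst₂ _▷_ (sym (rename-as-subst _)) (sym (rename-as-subst _)) (▷-subst p)

-- A renaming keeps every constructor and sends variables to variables, so it creates no redex. The
-- equation on `t₁` keeps the index of the step a variable, so that the step can be matched on.
rename-reflects-▷ : {t₁ t₁′ : Term k m′ n′} → t₁ ▷ t₁′ →
                    (t : Term k m n) → t₁ ≡ rename ρ ξ t → ∃[ t′ ] t ▷ t′ × t₁′ ≡ rename ρ ξ t′
rename-reflects-▷ ▷λ ⟨ λˡ t , t′ ∙ʳ e ⟩ refl =
  _ , ▷λ , cong (λ e′ → ⟨ _ , μʳ ⟨ _ , e′ ⟩ ⟩) (sym (rename-weakenˡ e))
rename-reflects-▷ ▷λ̄ ⟨ e′ ∙ˡ t , λʳ e ⟩ refl =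
  _ , ▷λ̄ , cong (λ t′ → ⟨ μˡ ⟨ t′ , _ ⟩ , _ ⟩) (sym (rename-weakenʳ t))
rename-reflects-▷ ▷μ ⟨ μˡ s , e ⟩ refl = _ , ▷μ , sym (rename-[]ʳ s e)
rename-reflects-▷ ▷μ̃ ⟨ t , μʳ s ⟩ refl = _ , ▷μ̃ , sym (rename-[]ˡ s t)
rename-reflects-▷ (ξ-cutˡ p) ⟨ t , e ⟩ refl
  with _ , q , eq ← rename-reflects-▷ p t refl = _ , ξ-cutˡ q , cong ⟨_, _ ⟩ eq
rename-reflects-▷ (ξ-cutʳ p) ⟨ t , e ⟩ refl
  with _ , q , eq ← rename-reflects-▷ p e refl = _ , ξ-cutʳ q , cong ⟨ _ ,_⟩ eq
rename-reflects-▷ (ξ-λˡ p)   (λˡ t)    refl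
  with _ , q , eq ← rename-reflects-▷ p t refl = _ , ξ-λˡ q , cong λˡ eq
rename-reflects-▷ (ξ-μˡ p)   (μˡ s)    refl
  with _ , q , eq ← rename-reflects-▷ p s refl = _ , ξ-μˡ q , cong μˡ eq
rename-reflects-▷ (ξ-∙ˡ₁ p)  (e ∙ˡ t)  refl
  with _ , q , eq ← rename-reflects-▷ p e refl = _ , ξ-∙ˡ₁ q , cong (_∙ˡ _) eq
rename-reflects-▷ (ξ-∙ˡ₂ p)  (e ∙ˡ t)  refl
  with _ , q , eq ← rename-reflects-▷ p t refl = _ , ξ-∙ˡ₂ q , cong (_ ∙ˡ_) eq
rename-reflects-▷ (ξ-λʳ p)   (λʳ e)    refl
  with _ , q , eq ← rename-reflects-▷ p e refl = _ , ξ-λʳ q , cong λʳ eq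
rename-reflects-▷ (ξ-μʳ p)   (μʳ s)    refl
  with _ , q , eq ← rename-reflects-▷ p s refl = _ , ξ-μʳ q , cong μʳ eq
rename-reflects-▷ (ξ-∙ʳ₁ p)  (t ∙ʳ e)  refl
  with _ , q , eq ← rename-reflects-▷ p t refl = _ , ξ-∙ʳ₁ q , cong (_∙ʳ _) eq
rename-reflects-▷ (ξ-∙ʳ₂ p)  (t ∙ʳ e)  refl
  with _ , q , eq ← rename-reflects-▷ p e refl = _ , ξ-∙ʳ₂ q , cong (_ ∙ʳ_) eq

▷*-liftˡ : (∀ x → Star _▷_ (σ₁ x) (σ₂ x)) → ∀ x → Star _▷_ (liftˡ σ₁ x) (liftˡ σ₂ x)
▷*-liftˡ f zero    = ε
▷*-liftˡ f (suc x) = gmap weakenˡ ▷-rename (f x)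

▷*-liftʳ : (∀ α → Star _▷_ (τ₁ α) (τ₂ α)) → ∀ α → Star _▷_ (liftʳ τ₁ α) (liftʳ τ₂ α)
▷*-liftʳ g zero    = ε
▷*-liftʳ g (suc α) = gmap weakenʳ ▷-rename (g α)

-- Many steps are unavoidable even when one value makes one step: its variable may occur any number
-- of times, including none.
▷*-subst : (∀ x → Star _▷_ (σ₁ x) (σ₂ x)) → (∀ α → Star _▷_ (τ₁ α) (τ₂ α)) →
           (t : Term k m n) → Star _▷_ (subst σ₁ τ₁ t) (subst σ₂ τ₂ t)
▷*-subst f g ⟨ t , e ⟩ = gmap ⟨_, _ ⟩ ξ-cutˡ (▷*-subst f g t) ◅◅ gmap ⟨ _ ,_⟩ ξ-cutʳ (▷*-subst f g e)
▷*-subst f g (varˡ x)  = f x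
▷*-subst f g (λˡ t)    = gmap λˡ ξ-λˡ (▷*-subst (▷*-liftˡ f) (gmap weakenˡ ▷-rename ∘ g) t)
▷*-subst f g (μˡ s)    = gmap μˡ ξ-μˡ (▷*-subst (gmap weakenʳ ▷-rename ∘ f) (▷*-liftʳ g) s)
▷*-subst f g (e ∙ˡ t)  = gmap (_∙ˡ _) ξ-∙ˡ₁ (▷*-subst f g e) ◅◅ gmap (_ ∙ˡ_) ξ-∙ˡ₂ (▷*-subst f g t)
▷*-subst f g (varʳ α)  = g α
▷*-subst f g (λʳ e)    = gmap λʳ ξ-λʳ (▷*-subst (gmap weakenʳ ▷-rename ∘ f) (▷*-liftʳ g) e)
▷*-subst f g (μʳ s)    = gmap μʳ ξ-μʳ (▷*-subst (▷*-liftˡ f) (gmap weakenˡ ▷-rename ∘ g) s)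
▷*-subst f g (t ∙ʳ e)  = gmap (_∙ʳ _) ξ-∙ʳ₁ (▷*-subst f g t) ◅◅ gmap (_ ∙ʳ_) ξ-∙ʳ₂ (▷*-subst f g e)

▷*-[]ˡ : (s : Term k (suc m) n) {t t′ : Term l m n} → t ▷ t′ → Star _▷_ (s [ t ]ˡ) (s [ t′ ]ˡ)
▷*-[]ˡ s p = ▷*-subst (λ { zero → p ◅ ε ; (suc x) → ε }) (λ _ → ε) s

▷*-[]ʳ : (s : Term k m (suc n)) {e e′ : Term r m n} → e ▷ e′ → Star _▷_ (s [ e ]ʳ) (s [ e′ ]ʳ)
▷*-[]ʳ s p = ▷*-subst (λ _ → ε) (λ { zero → p ◅ ε ; (suc α) → ε }) s

-- Accessibility

SN : Term k m n → Set
SN = Acc (flip _▷_)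

SN-▷* : {t t′ : Term k m n} → SN t → Star _▷_ t t′ → SN t′
SN-▷* a ε        = a
SN-▷* a (p ◅ ps) = SN-▷* (acc-inverse a p) ps

SN-rename : {t : Term k m n} → SN t → SN (rename ρ ξ t)
SN-rename {ρ = ρ} {ξ = ξ} (acc a) = acc λ p → step (rename-reflects-▷ p _ refl)
  where
  step : ∀ {t₁′} → ∃[ t′ ] _ ▷ t′ × t₁′ ≡ rename ρ ξ t′ → SN t₁′
  step (_ , q , refl) = SN-rename (a q)

SN-λˡ : {t : Term l (suc m) n} → SN t → SN (λˡ t)
SN-λˡ (acc a) = acc λ { (ξ-λˡ p) → SN-λˡ (a p) }

SN-μˡ : {s : Term c m (suc n)} → SN s → SN (μˡ s)
SN-μˡ (acc a) = acc λ { (ξ-μˡ p) → SN-μˡ (a p) }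

SN-λʳ : {e : Term r m (suc n)} → SN e → SN (λʳ e)
SN-λʳ (acc a) = acc λ { (ξ-λʳ p) → SN-λʳ (a p) }

SN-μʳ : {s : Term c (suc m) n} → SN s → SN (μʳ s)
SN-μʳ (acc a) = acc λ { (ξ-μʳ p) → SN-μʳ (a p) }

SN-∙ˡ : {e : Term r m n} {t : Term l m n} → SN e → SN t → SN (e ∙ˡ t)
SN-∙ˡ (acc a) (acc b) = acc λ { (ξ-∙ˡ₁ p) → SN-∙ˡ (a p) (acc b) ; (ξ-∙ˡ₂ p) → SN-∙ˡ (acc a) (b p) }

SN-∙ʳ : {t : Term l m n} {e : Term r m n} → SN t → SN e → SN (t ∙ʳ e)
SN-∙ʳ (acc a) (acc b) = acc λ { (ξ-∙ʳ₁ p) → SN-∙ʳ (a p) (acc b) ; (ξ-∙ʳ₂ p) → SN-∙ʳ (acc a) (b p) }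

SN-var : {x : Fin m} → SN (varˡ {n = n} x)
SN-var = acc λ ()

SN-covar : {α : Fin n} → SN (varʳ {m = m} α)
SN-covar = acc λ ()

-- Steps from `t` are carried by `f` to steps from `f t`. With a constructor as `f`, strong
-- normalization passes to immediate subterms.
SN-inverse : (f : Term j m n → Term k m′ n′) → (∀ {u v} → u ▷ v → f u ▷ f v) →
             ∀ {t} → SN (f t) → SN t
SN-inverse f mono (acc a) = acc λ p → SN-inverse f mono (a (mono p))

-- Root contractions of a cut

SNμ SNμ̃ SNλ SNλ̄ : Term l m n → Term r m n → Set
SNμ (μˡ s) e = SN (s [ e ]ʳ)
SNμ _      _ = ⊤

SNμ̃ t (μʳ s) = SN (s [ t ]ˡ)
SNμ̃ _ _      = ⊤

SNλ (λˡ t) (t′ ∙ʳ e) = SN ⟨ t′ , μʳ ⟨ t , weakenˡ e ⟩ ⟩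
SNλ _      _         = ⊤

SNλ̄ (e′ ∙ˡ t) (λʳ e) = SN ⟨ μˡ ⟨ weakenʳ t , e ⟩ , e′ ⟩
SNλ̄ _         _      = ⊤

-- `▷μ` and `▷μ̃` may both apply to one cut, so the contracta are recorded rule by rule; a field is
-- trivial when its rule does not apply.
record SNhead (t : Term l m n) (e : Term r m n) : Set where
  constructor snhead
  field
    snμ : SNμ t e
    snμ̃ : SNμ̃ t e
    snλ : SNλ t e
    snλ̄ : SNλ̄ t e

open SNhead

SNμ-▷ˡ : {t t′ : Term l m n} {e : Term r m n} → t ▷ t′ → SNμ t e → SNμ t′ e
SNμ-▷ˡ (ξ-μˡ p)  h = acc-inverse h (▷-subst p)
SNμ-▷ˡ (ξ-λˡ _)  h = tt
SNμ-▷ˡ (ξ-∙ˡ₁ _) h = tt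
SNμ-▷ˡ (ξ-∙ˡ₂ _) h = tt

SNμ-▷ʳ : (t : Term l m n) {e e′ : Term r m n} → e ▷ e′ → SNμ t e → SNμ t e′
SNμ-▷ʳ (μˡ s)   p h = SN-▷* h (▷*-[]ʳ s p)
SNμ-▷ʳ (varˡ _) p h = tt
SNμ-▷ʳ (λˡ _)   p h = tt
SNμ-▷ʳ (_ ∙ˡ _) p h = tt

SNμ̃-▷ˡ : {t t′ : Term l m n} (e : Term r m n) → t ▷ t′ → SNμ̃ t e → SNμ̃ t′ e
SNμ̃-▷ˡ (μʳ s)   p h = SN-▷* h (▷*-[]ˡ s p)
SNμ̃-▷ˡ (varʳ _) p h = tt
SNμ̃-▷ˡ (λʳ _)   p h = tt
SNμ̃-▷ˡ (_ ∙ʳ _) p h = tt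

SNμ̃-▷ʳ : {t : Term l m n} {e e′ : Term r m n} → e ▷ e′ → SNμ̃ t e → SNμ̃ t e′
SNμ̃-▷ʳ (ξ-μʳ p)  h = acc-inverse h (▷-subst p)
SNμ̃-▷ʳ (ξ-λʳ _)  h = tt
SNμ̃-▷ʳ (ξ-∙ʳ₁ _) h = tt
SNμ̃-▷ʳ (ξ-∙ʳ₂ _) h = tt

SNλ-▷ˡ : {t t′ : Term l m n} (e : Term r m n) → t ▷ t′ → SNλ t e → SNλ t′ e
SNλ-▷ˡ (_ ∙ʳ _) (ξ-λˡ p)  h = acc-inverse h (ξ-cutʳ (ξ-μʳ (ξ-cutˡ p)))
SNλ-▷ˡ (varʳ _) (ξ-λˡ _)  h = tt
SNλ-▷ˡ (λʳ _)   (ξ-λˡ _)  h = tt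
SNλ-▷ˡ (μʳ _)   (ξ-λˡ _)  h = tt
SNλ-▷ˡ _        (ξ-μˡ _)  h = tt
SNλ-▷ˡ _        (ξ-∙ˡ₁ _) h = tt
SNλ-▷ˡ _        (ξ-∙ˡ₂ _) h = tt

SNλ-▷ʳ : (t : Term l m n) {e e′ : Term r m n} → e ▷ e′ → SNλ t e → SNλ t e′
SNλ-▷ʳ (λˡ _)   (ξ-∙ʳ₁ p) h = acc-inverse h (ξ-cutˡ p)
SNλ-▷ʳ (λˡ _)   (ξ-∙ʳ₂ p) h = acc-inverse h (ξ-cutʳ (ξ-μʳ (ξ-cutʳ (▷-rename p))))
SNλ-▷ʳ (λˡ _)   (ξ-λʳ _)  h = tt
SNλ-▷ʳ (λˡ _)   (ξ-μʳ _)  h = tt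
SNλ-▷ʳ (varˡ _) _         h = tt
SNλ-▷ʳ (μˡ _)   _         h = tt
SNλ-▷ʳ (_ ∙ˡ _) _         h = tt

SNλ̄-▷ˡ : {t t′ : Term l m n} (e : Term r m n) → t ▷ t′ → SNλ̄ t e → SNλ̄ t′ e
SNλ̄-▷ˡ (λʳ _)   (ξ-∙ˡ₁ p) h = acc-inverse h (ξ-cutʳ p)
SNλ̄-▷ˡ (λʳ _)   (ξ-∙ˡ₂ p) h = acc-inverse h (ξ-cutˡ (ξ-μˡ (ξ-cutˡ (▷-rename p))))
SNλ̄-▷ˡ (λʳ _)   (ξ-λˡ _)  h = tt
SNλ̄-▷ˡ (λʳ _)   (ξ-μˡ _)  h = tt
SNλ̄-▷ˡ (varʳ _) (ξ-∙ˡ₁ _) h = tt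
SNλ̄-▷ˡ (varʳ _) (ξ-∙ˡ₂ _) h = tt
SNλ̄-▷ˡ (varʳ _) (ξ-λˡ _)  h = tt
SNλ̄-▷ˡ (varʳ _) (ξ-μˡ _)  h = tt
SNλ̄-▷ˡ (μʳ _)   (ξ-∙ˡ₁ _) h = tt
SNλ̄-▷ˡ (μʳ _)   (ξ-∙ˡ₂ _) h = tt
SNλ̄-▷ˡ (μʳ _)   (ξ-λˡ _)  h = tt
SNλ̄-▷ˡ (μʳ _)   (ξ-μˡ _)  h = tt
SNλ̄-▷ˡ (_ ∙ʳ _) (ξ-∙ˡ₁ _) h = tt
SNλ̄-▷ˡ (_ ∙ʳ _) (ξ-∙ˡ₂ _) h = tt
SNλ̄-▷ˡ (_ ∙ʳ _) (ξ-λˡ _)  h = tt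
SNλ̄-▷ˡ (_ ∙ʳ _) (ξ-μˡ _)  h = tt

SNλ̄-▷ʳ : (t : Term l m n) {e e′ : Term r m n} → e ▷ e′ → SNλ̄ t e → SNλ̄ t e′
SNλ̄-▷ʳ (_ ∙ˡ _) (ξ-λʳ p)  h = acc-inverse h (ξ-cutˡ (ξ-μˡ (ξ-cutʳ p)))
SNλ̄-▷ʳ (_ ∙ˡ _) (ξ-μʳ _)  h = tt
SNλ̄-▷ʳ (_ ∙ˡ _) (ξ-∙ʳ₁ _) h = tt
SNλ̄-▷ʳ (_ ∙ˡ _) (ξ-∙ʳ₂ _) h = tt
SNλ̄-▷ʳ (varˡ _) _         h = tt
SNλ̄-▷ʳ (λˡ _)   _         h = tt
SNλ̄-▷ʳ (μˡ _)   _         h = tt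

-- Every root rule rewrites a c-term, so a step of `t` keeps its outermost constructor and creates
-- no root redex of the cut. Each contractum follows the step of `t` by zero or more steps. The same
-- reason applies to steps of `e`.
SNhead-▷ˡ : {t t′ : Term l m n} {e : Term r m n} → t ▷ t′ → SNhead t e → SNhead t′ e
SNhead-▷ˡ p (snhead h h′ h″ h‴) = snhead (SNμ-▷ˡ p h) (SNμ̃-▷ˡ _ p h′) (SNλ-▷ˡ _ p h″) (SNλ̄-▷ˡ _ p h‴)

SNhead-▷ʳ : {t : Term l m n} {e e′ : Term r m n} → e ▷ e′ → SNhead t e → SNhead t e′
SNhead-▷ʳ p (snhead h h′ h″ h‴) = snhead (SNμ-▷ʳ _ p h) (SNμ̃-▷ʳ p h′) (SNλ-▷ʳ _ p h″) (SNλ̄-▷ʳ _ p h‴)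

-- Induction on both accessibility proofs: a root step is covered by `SNhead`, and a step inside `t`
-- or `e` preserves `SNhead` while shrinking one of the two proofs.
SN-cut : {t : Term l m n} {e : Term r m n} → SN t → SN e → SNhead t e → SN ⟨ t , e ⟩
SN-cut-▷ : {t : Term l m n} {e : Term r m n} {s : Term c m n} →
           SN t → SN e → SNhead t e → ⟨ t , e ⟩ ▷ s → SN s
SN-cut a b h = acc λ p → SN-cut-▷ a b h p
SN-cut-▷ a b h ▷λ = snλ h
SN-cut-▷ a b h ▷λ̄ = snλ̄ h
SN-cut-▷ a b h ▷μ = snμ h
SN-cut-▷ a b h ▷μ̃ = snμ̃ h
SN-cut-▷ (acc a) b h (ξ-cutˡ p) = SN-cut (a p) b (SNhead-▷ˡ p h)
SN-cut-▷ a (acc b) h (ξ-cutʳ p) = SN-cut a (b p) (SNhead-▷ʳ p h)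

-- Substitutions creating no root redex

data IsVar : Term k m n → Set where
  isvarˡ : {x : Fin m} → IsVar (varˡ {n = n} x)
  isvarʳ : {α : Fin n} → IsVar (varʳ {m = m} α)

IsVar-rename : {X : Term k m n} → IsVar X → IsVar (rename ρ ξ X)
IsVar-rename isvarˡ = isvarˡ
IsVar-rename isvarʳ = isvarʳ

IsVar-SN : {X : Term k m n} → IsVar X → SN X
IsVar-SN isvarˡ = SN-var
IsVar-SN isvarʳ = SN-covar

-- A substitution can change the outermost constructor of one side of a cut only when that side is a
-- variable. Requiring its value to be a variable again rules out new root redexes from that side.
Rigidˡ : (Fin m → Term l m′ n′) → Term l m n → Set
Rigidˡ σ (varˡ x) = IsVar (σ x)
Rigidˡ σ _        = ⊤

Rigidʳ : (Fin n → Term r m′ n′) → Term r m n → Set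
Rigidʳ τ (varʳ α) = IsVar (τ α)
Rigidʳ τ _        = ⊤

IsVar-SNμ : {X : Term l m n} {E : Term r m n} → IsVar X → SNμ X E
IsVar-SNμ isvarˡ = tt

IsVar-SNμ̃ : {X : Term l m n} {E : Term r m n} → IsVar E → SNμ̃ X E
IsVar-SNμ̃ isvarʳ = tt

-- By rigidity the substituted term starts with `μˡ` only if `u` does. `E` is arbitrary because the
-- two sides of a cut will carry different substitutions in `SN-cut-subst`.
SNμ-subst : (u : Term l m n) {E : Term r m′ n′} → Rigidˡ σ u →
            (∀ {s} → u ≡ μˡ s → SN (subst σ (E ∷ᶠ τ) s)) → SNμ (subst σ τ u) E
SNμ-subst (varˡ x) v h = IsVar-SNμ v
SNμ-subst (λˡ t)   _ h = tt
SNμ-subst (μˡ s)   _ h = ≡.subst SN (sym (lift-[]ʳ s _)) (h refl)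
SNμ-subst (e ∙ˡ t) _ h = tt

SNμ̃-subst : (e : Term r m n) {X : Term l m′ n′} → Rigidʳ τ e →
            (∀ {s} → e ≡ μʳ s → SN (subst (X ∷ᶠ σ) τ s)) → SNμ̃ X (subst σ τ e)
SNμ̃-subst (varʳ α) v h = IsVar-SNμ̃ v
SNμ̃-subst (λʳ e)   _ h = tt
SNμ̃-subst (μʳ s)   _ h = ≡.subst SN (sym (lift-[]ˡ s _)) (h refl)
SNμ̃-subst (t ∙ʳ e) _ h = tt

SNλ-subst : (t : Term l m n) (e : Term r m n) → Rigidˡ σ t → Rigidʳ τ e →
            (∀ {s} → ⟨ t , e ⟩ ▷ s → SN (subst σ τ s)) → SNλ (subst σ τ t) (subst σ τ e)
SNλ-subst {σ = σ} (varˡ x) _ v _ h with σ x | v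
... | _ | isvarˡ = tt
SNλ-subst {τ = τ} (λˡ t) (varʳ α) _ v h with τ α | v
... | _ | isvarʳ = tt
SNλ-subst (λˡ t)   (λʳ e)    _ _ h = tt
SNλ-subst (λˡ t)   (μʳ s)    _ _ h = tt
SNλ-subst (λˡ t)   (t′ ∙ʳ e) _ _ h = ≡.subst (λ e′ → SN ⟨ _ , μʳ ⟨ _ , e′ ⟩ ⟩) (subst-weakenˡ e) (h ▷λ)
SNλ-subst (μˡ s)   _         _ _ h = tt
SNλ-subst (e ∙ˡ t) _         _ _ h = tt

SNλ̄-subst : (t : Term l m n) (e : Term r m n) → Rigidˡ σ t → Rigidʳ τ e →
            (∀ {s} → ⟨ t , e ⟩ ▷ s → SN (subst σ τ s)) → SNλ̄ (subst σ τ t) (subst σ τ e)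
SNλ̄-subst {σ = σ} (varˡ x) _ v _ h with σ x | v
... | _ | isvarˡ = tt
SNλ̄-subst {τ = τ} (e′ ∙ˡ t) (varʳ α) _ v h with τ α | v
... | _ | isvarʳ = tt
SNλ̄-subst (e′ ∙ˡ t) (λʳ e)    _ _ h = ≡.subst (λ t′ → SN ⟨ μˡ ⟨ t′ , _ ⟩ , _ ⟩) (subst-weakenʳ t) (h ▷λ̄)
SNλ̄-subst (e′ ∙ˡ t) (μʳ s)    _ _ h = tt
SNλ̄-subst (e′ ∙ˡ t) (t′ ∙ʳ e) _ _ h = tt
SNλ̄-subst (μˡ s)    _         _ _ h = tt
SNλ̄-subst (λˡ t)    _         _ _ h = tt

-- When both sides are rigid, every root redex after substitution is the image of one before it, and
-- its contractum is the substituted contractum.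
SNhead-subst : (t : Term l m n) (e : Term r m n) → Rigidˡ σ t → Rigidʳ τ e →
               (∀ {s} → ⟨ t , e ⟩ ▷ s → SN (subst σ τ s)) → SNhead (subst σ τ t) (subst σ τ e)
SNhead-subst t e v w h = record
  { snμ = SNμ-subst t v λ { {s} refl → ≡.subst SN (subst-[]ʳ s e) (h ▷μ) }
  ; snμ̃ = SNμ̃-subst e w λ { {s} refl → ≡.subst SN (subst-[]ˡ s t) (h ▷μ̃) }
  ; snλ = SNλ-subst t e v w h
  ; snλ̄ = SNλ̄-subst t e v w h }

-- Descent to reducts and subterms

infix 4 _≺_
data _≺_ : Term j m′ n′ → Term k m n → Set where
  red  : {t t′ : Term k m n} → t ▷ t′ → t′ ≺ t
  cutˡ : {t : Term l m n} {e : Term r m n} → t ≺ ⟨ t , e ⟩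
  cutʳ : {t : Term l m n} {e : Term r m n} → e ≺ ⟨ t , e ⟩
  inλˡ : {t : Term l (suc m) n} → t ≺ λˡ t
  inμˡ : {s : Term c m (suc n)} → s ≺ μˡ s
  ∙ˡ₁  : {e : Term r m n} {t : Term l m n} → e ≺ e ∙ˡ t
  ∙ˡ₂  : {e : Term r m n} {t : Term l m n} → t ≺ e ∙ˡ t
  inλʳ : {e : Term r m (suc n)} → e ≺ λʳ e
  inμʳ : {s : Term c (suc m) n} → s ≺ μʳ s
  ∙ʳ₁  : {t : Term l m n} {e : Term r m n} → t ≺ t ∙ʳ e
  ∙ʳ₂  : {t : Term l m n} {e : Term r m n} → e ≺ t ∙ʳ e

-- Accessibility for `≺`, which relates terms of different kinds and scopes.
data Tree (t : Term k m n) : Set where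
  node : (∀ {j m′ n′} {u : Term j m′ n′} → u ≺ t → Tree u) → Tree t

subtree : {t : Term k m n} {u : Term j m′ n′} → Tree t → u ≺ t → Tree u
subtree (node rs) = rs

-- A reduct of a subterm of t is a subterm of a reduct of t.
tree-of-reducts : (t : Term k m n) → (∀ {t′} → t ▷ t′ → Tree t′) → Tree t
tree-of-reducts ⟨ t , e ⟩ f = node λ
  { (red p) → f p
  ; cutˡ    → tree-of-reducts t λ p → subtree (f (ξ-cutˡ p)) cutˡ
  ; cutʳ    → tree-of-reducts e λ p → subtree (f (ξ-cutʳ p)) cutʳ }
tree-of-reducts (varˡ x) f = node λ { (red p) → f p }
tree-of-reducts (λˡ t)   f = node λ
  { (red p) → f p
  ; inλˡ    → tree-of-reducts t λ p → subtree (f (ξ-λˡ p)) inλˡ }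
tree-of-reducts (μˡ s)   f = node λ
  { (red p) → f p
  ; inμˡ    → tree-of-reducts s λ p → subtree (f (ξ-μˡ p)) inμˡ }
tree-of-reducts (e ∙ˡ t) f = node λ
  { (red p) → f p
  ; ∙ˡ₁     → tree-of-reducts e λ p → subtree (f (ξ-∙ˡ₁ p)) ∙ˡ₁
  ; ∙ˡ₂     → tree-of-reducts t λ p → subtree (f (ξ-∙ˡ₂ p)) ∙ˡ₂ }
tree-of-reducts (varʳ α) f = node λ { (red p) → f p }
tree-of-reducts (λʳ e)   f = node λ
  { (red p) → f p
  ; inλʳ    → tree-of-reducts e λ p → subtree (f (ξ-λʳ p)) inλʳ }
tree-of-reducts (μʳ s)   f = node λ
  { (red p) → f p
  ; inμʳ    → tree-of-reducts s λ p → subtree (f (ξ-μʳ p)) inμʳ }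
tree-of-reducts (t ∙ʳ e) f = node λ
  { (red p) → f p
  ; ∙ʳ₁     → tree-of-reducts t λ p → subtree (f (ξ-∙ʳ₁ p)) ∙ʳ₁
  ; ∙ʳ₂     → tree-of-reducts e λ p → subtree (f (ξ-∙ʳ₂ p)) ∙ʳ₂ }

SN⇒Tree : {t : Term k m n} → SN t → Tree t
SN⇒Tree (acc a) = tree-of-reducts _ λ p → SN⇒Tree (a p)

-- Typing

module _ {a} {Atom : Set a} where

  private variable
    A B : Type Atom
    Γ Γ′ Γ₀ Γ₁ : Context Atom m
    Δ Δ′ Δ₀ Δ₁ : Context Atom n

  -- For a c-term the type is a dummy.
  Typing : (k : Kind) → Context Atom m → Context Atom n → Term k m n → Type Atom → Set a
  Typing c Γ Δ s _ = s ∶⟨ Γ ⊢ Δ ⟩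
  Typing l Γ Δ t A = Γ ⊢[ t ∶ A ], Δ
  Typing r Γ Δ e A = Γ ,[ e ∶ A ]⊢ Δ

  Renames : Context Atom m → Context Atom m′ → (Fin m → Fin m′) → Set a
  Renames Γ Γ′ ρ = ∀ x → lookup Γ′ (ρ x) ≡ lookup Γ x

  lift-renames : Renames Γ Γ′ ρ → Renames (A ∷ Γ) (A ∷ Γ′) (lift 1 ρ)
  lift-renames f zero    = refl
  lift-renames f (suc x) = f x

  typing-rename : (t : Term k m n) → Typing k Γ Δ t A → Renames Γ Γ′ ρ → Renames Δ Δ′ ξ →
                  Typing k Γ′ Δ′ (rename ρ ξ t) A
  typing-rename ⟨ t , e ⟩ (cut d d′)    f g = cut (typing-rename t d f g) (typing-rename e d′ f g)
  typing-rename (varˡ x) (axˡ eq)       f g = axˡ (trans (f x) eq)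
  typing-rename (λˡ t)   (⇒-r d)        f g = ⇒-r (typing-rename t d (lift-renames f) g)
  typing-rename {A = A} (μˡ s) (act-r d) f g =
    act-r (typing-rename {A = A} s d f (lift-renames g))
  typing-rename (e ∙ˡ t) (minus-r d d′) f g = minus-r (typing-rename t d f g) (typing-rename e d′ f g)
  typing-rename (varʳ α) (axʳ eq)       f g = axʳ (trans (g α) eq)
  typing-rename (λʳ e)   (minus-l d)    f g =
    minus-l (typing-rename e d f (lift-renames g))
  typing-rename {A = A} (μʳ s) (act-l d) f g =
    act-l (typing-rename {A = A} s d (lift-renames f) g)
  typing-rename (t ∙ʳ e) (⇒-l d d′)     f g = ⇒-l (typing-rename t d f g) (typing-rename e d′ f g)

  typing-weakenˡ : (t : Term k m n) → Typing k Γ Δ t A → Typing k (B ∷ Γ) Δ (weakenˡ t) A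
  typing-weakenˡ t d = typing-rename t d (λ _ → refl) (λ _ → refl)

  typing-weakenʳ : (t : Term k m n) → Typing k Γ Δ t A → Typing k Γ (B ∷ Δ) (weakenʳ t) A
  typing-weakenʳ t d = typing-rename t d (λ _ → refl) (λ _ → refl)

  Substˡ : Context Atom m → Context Atom m′ → Context Atom n′ → (Fin m → Term l m′ n′) → Set a
  Substˡ Γ Γ′ Δ′ σ = ∀ x → Γ′ ⊢[ σ x ∶ lookup Γ x ], Δ′

  Substʳ : Context Atom n → Context Atom m′ → Context Atom n′ → (Fin n → Term r m′ n′) → Set a
  Substʳ Δ Γ′ Δ′ τ = ∀ α → Γ′ ,[ τ α ∶ lookup Δ α ]⊢ Δ′

  Substˡ-liftˡ : Substˡ Γ Γ′ Δ′ σ → Substˡ (A ∷ Γ) (A ∷ Γ′) Δ′ (liftˡ σ)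
  Substˡ-liftˡ f zero    = axˡ refl
  Substˡ-liftˡ f (suc x) = typing-weakenˡ _ (f x)

  Substʳ-liftʳ : Substʳ Δ Γ′ Δ′ τ → Substʳ (A ∷ Δ) Γ′ (A ∷ Δ′) (liftʳ τ)
  Substʳ-liftʳ g zero    = axʳ refl
  Substʳ-liftʳ g (suc α) = typing-weakenʳ _ (g α)

  typing-subst : (t : Term k m n) → Typing k Γ Δ t A → Substˡ Γ Γ′ Δ′ σ → Substʳ Δ Γ′ Δ′ τ →
                 Typing k Γ′ Δ′ (subst σ τ t) A
  typing-subst ⟨ t , e ⟩ (cut d d′)    f g = cut (typing-subst t d f g) (typing-subst e d′ f g)
  typing-subst (varˡ x) (axˡ refl)     f g = f x
  typing-subst (λˡ t)   (⇒-r d)        f g = ⇒-r (typing-subst t d (Substˡ-liftˡ f) (typing-weakenˡ _ ∘ g))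
  typing-subst {A = A} (μˡ s) (act-r d) f g =
    act-r (typing-subst {A = A} s d (typing-weakenʳ _ ∘ f) (Substʳ-liftʳ g))
  typing-subst (e ∙ˡ t) (minus-r d d′) f g = minus-r (typing-subst t d f g) (typing-subst e d′ f g)
  typing-subst (varʳ α) (axʳ refl)     f g = g α
  typing-subst (λʳ e)   (minus-l d)    f g =
    minus-l (typing-subst e d (typing-weakenʳ _ ∘ f) (Substʳ-liftʳ g))
  typing-subst {A = A} (μʳ s) (act-l d) f g =
    act-l (typing-subst {A = A} s d (Substˡ-liftˡ f) (typing-weakenˡ _ ∘ g))
  typing-subst (t ∙ʳ e) (⇒-l d d′)     f g = ⇒-l (typing-subst t d f g) (typing-subst e d′ f g)

  -- `SN-subst` recurs on reducts, and goodness only speaks of cuts with terms of type `A`; typing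
  -- must therefore survive reduction.
  subject-reduction : {t t′ : Term k m n} → t ▷ t′ → Typing k Γ Δ t A → Typing k Γ Δ t′ A
  subject-reduction (▷λ {e = e}) (cut (⇒-r d) (⇒-l d′ d″)) =
    cut d′ (act-l (cut d (typing-weakenˡ e d″)))
  subject-reduction (▷λ̄ {t = t}) (cut (minus-r d d′) (minus-l d″)) =
    cut (act-r (cut (typing-weakenʳ t d) d″)) d′
  subject-reduction {A = A} (▷μ {s = s}) (cut (act-r d) d′) =
    typing-subst {A = A} s d (λ _ → axˡ refl) (λ { zero → d′ ; (suc α) → axʳ refl })
  subject-reduction {A = A} (▷μ̃ {s = s}) (cut d (act-l d′)) =
    typing-subst {A = A} s d′ (λ { zero → d ; (suc x) → axˡ refl }) (λ _ → axʳ refl)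
  subject-reduction (ξ-cutˡ p) (cut d d′)     = cut (subject-reduction p d) d′
  subject-reduction (ξ-cutʳ p) (cut d d′)     = cut d (subject-reduction p d′)
  subject-reduction (ξ-λˡ p)   (⇒-r d)        = ⇒-r (subject-reduction p d)
  subject-reduction {A = A} (ξ-μˡ p)   (act-r d) = act-r (subject-reduction {A = A} p d)
  subject-reduction (ξ-∙ˡ₁ p)  (minus-r d d′) = minus-r d (subject-reduction p d′)
  subject-reduction (ξ-∙ˡ₂ p)  (minus-r d d′) = minus-r (subject-reduction p d) d′
  subject-reduction (ξ-λʳ p)   (minus-l d)    = minus-l (subject-reduction p d)
  subject-reduction {A = A} (ξ-μʳ p)   (act-l d) = act-l (subject-reduction {A = A} p d)
  subject-reduction (ξ-∙ʳ₁ p)  (⇒-l d d′)     = ⇒-l (subject-reduction p d) d′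
  subject-reduction (ξ-∙ʳ₂ p)  (⇒-l d d′)     = ⇒-l d (subject-reduction p d′)

  -- Good terms and good environments

  -- Good values are confined to kind `p` and type `A`; every other variable is sent to a variable.
  data Value (p : Kind) (A : Type Atom) (G : Term p m n → Set a) :
             (k : Kind) → Type Atom → Term k m n → Set a where
    var  : ∀ {X : Term k m n} → IsVar X → Value p A G k B X
    good : ∀ {X : Term p m n} → B ≡ A → G X → Value p A G p B X

  -- The predicate `G` is a parameter so that `Good` can recur through `Env` at smaller trees.
  record Env (p : Kind) (A : Type Atom)
             (G : ∀ {m n} → Context Atom m → Context Atom n → Term p m n → Set a)
             (Γ : Context Atom m) (Δ : Context Atom n) (Γ′ : Context Atom m′) (Δ′ : Context Atom n′)
             (σ : Fin m → Term l m′ n′) (τ : Fin n → Term r m′ n′) : Set a where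
    field
      typingˡ : Substˡ Γ Γ′ Δ′ σ
      typingʳ : Substʳ Δ Γ′ Δ′ τ
      valueˡ  : ∀ x → Value p A (G Γ′ Δ′) l (lookup Γ x) (σ x)
      valueʳ  : ∀ α → Value p A (G Γ′ Δ′) r (lookup Δ α) (τ α)

  open Env

  op : Kind → Kind
  op c = c
  op l = r
  op r = l

  -- Only used for p = l and p = r; the value at c is junk.
  plug : (p : Kind) → Term p m n → Term (op p) m n → Term c m n
  plug c s _ = s
  plug l t e = ⟨ t , e ⟩
  plug r e t = ⟨ t , e ⟩

  -- Goodness is closed under renaming because the cuts range over all renamings of
  -- X, as needed to push substitutions under binders.
  Good : (p : Kind) (A : Type Atom) {t : Term k m n} → Tree t →
         Context Atom m′ → Context Atom n′ → Term p m′ n′ → Set a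
  Good p A {t} (node rs) Γ₀ Δ₀ X =
    SN X ×
    (∀ {k m n} {u : Term k m n} (q : u ≺ t) → Good p A (rs q) Γ₀ Δ₀ X) ×
    (∀ {m n m′ n′} {u : Term (op p) m n} (q : u ≺ t)
       (Γ : Context Atom m) (Δ : Context Atom n) (Γ′ : Context Atom m′) (Δ′ : Context Atom n′) σ τ ρ ξ →
       Renames Γ₀ Γ′ ρ → Renames Δ₀ Δ′ ξ → Typing (op p) Γ Δ u A →
       Env p A (Good p A (rs q)) Γ Δ Γ′ Δ′ σ τ →
       SN (plug p (rename ρ ξ X) (subst σ τ u)))

  Good-SN : ∀ p {t : Term k m n} (T : Tree t) {X : Term p m′ n′} → Good p A T Γ Δ X → SN X
  Good-SN p (node rs) (sn , _) = sn

  Good-rename : ∀ p {t : Term k m n} (T : Tree t) {X : Term p m′ n′} →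
                Renames Γ₀ Γ₁ ρ → Renames Δ₀ Δ₁ ξ →
                Good p A T Γ₀ Δ₀ X → Good p A T Γ₁ Δ₁ (rename ρ ξ X)
  Good-rename p (node rs) {X} f g (sn , below , cut-sn) =
    SN-rename sn ,
    (λ q → Good-rename p (rs q) f g (below q)) ,
    λ q Γ Δ Γ′ Δ′ σ τ ρ ξ f′ g′ d η →
      ≡.subst (λ Y → SN (plug p Y _)) (sym (rename-rename (λ _ → refl) (λ _ → refl) X))
        (cut-sn q Γ Δ Γ′ Δ′ σ τ _ _ (λ x → trans (f′ _) (f x)) (λ α → trans (g′ _) (g α)) d η)

  Value-map : ∀ {p} {G H : Term p m n → Set a} {X : Term k m n} → (∀ {X} → G X → H X) →
              Value p A G k B X → Value p A H k B X
  Value-map h (var v)     = var v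
  Value-map h (good eq g) = good eq (h g)

  Value-rename : ∀ p {t : Term j m n} (T : Tree t) {X : Term k m′ n′} →
                 Renames Γ₀ Γ₁ ρ → Renames Δ₀ Δ₁ ξ →
                 Value p A (Good p A T Γ₀ Δ₀) k B X → Value p A (Good p A T Γ₁ Δ₁) k B (rename ρ ξ X)
  Value-rename p T f g (var v)     = var (IsVar-rename v)
  Value-rename p T f g (good eq h) = good eq (Good-rename p T f g h)

  Value-SN : ∀ p {t : Term j m n} (T : Tree t) {X : Term k m′ n′} →
             Value p A (Good p A T Γ Δ) k B X → SN X
  Value-SN p T (var v)    = IsVar-SN v
  Value-SN p T (good _ h) = Good-SN p T h

  -- This is what the second component of `Good` is for: goodness passes down `≺`, so an induction
  -- on the tree can carry its environment along.
  Env-≺ : ∀ p {t : Term k m n} {u : Term j m′ n′} (T : Tree t) (q : u ≺ t) →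
          Env p A (Good p A T) Γ Δ Γ′ Δ′ σ τ → Env p A (Good p A (subtree T q)) Γ Δ Γ′ Δ′ σ τ
  Env-≺ p (node rs) q η = record
    { typingˡ = typingˡ η
    ; typingʳ = typingʳ η
    ; valueˡ  = λ x → Value-map (λ (_ , below , _) → below q) (valueˡ η x)
    ; valueʳ  = λ α → Value-map (λ (_ , below , _) → below q) (valueʳ η α) }

  Env-rename : ∀ p {t : Term k m n} (T : Tree t) → Renames Γ₀ Γ₁ ρ → Renames Δ₀ Δ₁ ξ →
               Env p A (Good p A T) Γ Δ Γ₀ Δ₀ σ τ →
               Env p A (Good p A T) Γ Δ Γ₁ Δ₁ (rename ρ ξ ∘ σ) (rename ρ ξ ∘ τ)
  Env-rename p T f g η = record
    { typingˡ = λ x → typing-rename _ (typingˡ η x) f g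
    ; typingʳ = λ α → typing-rename _ (typingʳ η α) f g
    ; valueˡ  = λ x → Value-rename p T f g (valueˡ η x)
    ; valueʳ  = λ α → Value-rename p T f g (valueʳ η α) }

  Env-liftˡ : ∀ p {t : Term k m n} (T : Tree t) →
              Env p A (Good p A T) Γ Δ Γ′ Δ′ σ τ →
              Env p A (Good p A T) (B ∷ Γ) Δ (B ∷ Γ′) Δ′ (liftˡ σ) (weakenˡ ∘ τ)
  Env-liftˡ p T η = record
    { typingˡ = Substˡ-liftˡ (typingˡ η)
    ; typingʳ = λ α → typing-weakenˡ _ (typingʳ η α)
    ; valueˡ  = λ { zero → var isvarˡ ; (suc x) → Value-rename p T (λ _ → refl) (λ _ → refl) (valueˡ η x) }
    ; valueʳ  = λ α → Value-rename p T (λ _ → refl) (λ _ → refl) (valueʳ η α) }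

  Env-liftʳ : ∀ p {t : Term k m n} (T : Tree t) →
              Env p A (Good p A T) Γ Δ Γ′ Δ′ σ τ →
              Env p A (Good p A T) Γ (B ∷ Δ) Γ′ (B ∷ Δ′) (weakenʳ ∘ σ) (liftʳ τ)
  Env-liftʳ p T η = record
    { typingˡ = λ x → typing-weakenʳ _ (typingˡ η x)
    ; typingʳ = Substʳ-liftʳ (typingʳ η)
    ; valueˡ  = λ x → Value-rename p T (λ _ → refl) (λ _ → refl) (valueˡ η x)
    ; valueʳ  = λ { zero → var isvarʳ ; (suc α) → Value-rename p T (λ _ → refl) (λ _ → refl) (valueʳ η α) } }

  Env-id : ∀ p {t : Term k m n} (T : Tree t) → Env p A (Good p A T) Γ Δ Γ Δ varˡ varʳ
  Env-id p T = record
    { typingˡ = λ _ → axˡ refl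
    ; typingʳ = λ _ → axʳ refl
    ; valueˡ  = λ _ → var isvarˡ
    ; valueʳ  = λ _ → var isvarʳ }

  Env-consˡ : ∀ {t : Term k m n} (T : Tree t) {X : Term l m′ n′} →
              Γ′ ⊢[ X ∶ A ], Δ′ → Good l A T Γ′ Δ′ X → Env l A (Good l A T) Γ Δ Γ′ Δ′ σ τ →
              Env l A (Good l A T) (A ∷ Γ) Δ Γ′ Δ′ (X ∷ᶠ σ) τ
  Env-consˡ T d h η = record
    { typingˡ = λ { zero → d ; (suc x) → typingˡ η x }
    ; typingʳ = typingʳ η
    ; valueˡ  = λ { zero → good refl h ; (suc x) → valueˡ η x }
    ; valueʳ  = valueʳ η }

  Env-consʳ : ∀ {t : Term k m n} (T : Tree t) {X : Term r m′ n′} →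
              Γ′ ,[ X ∶ A ]⊢ Δ′ → Good r A T Γ′ Δ′ X → Env r A (Good r A T) Γ Δ Γ′ Δ′ σ τ →
              Env r A (Good r A T) Γ (A ∷ Δ) Γ′ Δ′ σ (X ∷ᶠ τ)
  Env-consʳ T d h η = record
    { typingˡ = typingˡ η
    ; typingʳ = λ { zero → d ; (suc α) → typingʳ η α }
    ; valueˡ  = valueˡ η
    ; valueʳ  = λ { zero → good refl h ; (suc α) → valueʳ η α } }

  -- The good case identifies `B` with `A`. As `e ≺ ⟨ t , e ⟩`, goodness of `X` at the tree of the
  -- whole cut, taken at the identity renaming, then yields strong normalization directly.
  Good-cutˡ : ∀ p {t : Term l m n} {e : Term r m n} (T : Tree ⟨ t , e ⟩) {X : Term l m′ n′} →
              Γ ,[ e ∶ B ]⊢ Δ → Env p A (Good p A T) Γ Δ Γ′ Δ′ σ τ →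
              Value p A (Good p A T Γ′ Δ′) l B X → SN ⟨ X , subst σ τ e ⟩ ⊎ IsVar X
  Good-cutˡ p T d η (var v) = inj₂ v
  Good-cutˡ .l (node rs) {X} d η (good refl (_ , _ , h)) =
    inj₁ (≡.subst (λ Y → SN ⟨ Y , _ ⟩) (rename-id X)
      (h cutʳ _ _ _ _ _ _ id id (λ _ → refl) (λ _ → refl) d (Env-≺ l (node rs) cutʳ η)))

  Good-cutʳ : ∀ p {t : Term l m n} {e : Term r m n} (T : Tree ⟨ t , e ⟩) {X : Term r m′ n′} →
              Γ ⊢[ t ∶ B ], Δ → Env p A (Good p A T) Γ Δ Γ′ Δ′ σ τ →
              Value p A (Good p A T Γ′ Δ′) r B X → SN ⟨ subst σ τ t , X ⟩ ⊎ IsVar X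
  Good-cutʳ p T d η (var v) = inj₂ v
  Good-cutʳ .r (node rs) {X} d η (good refl (_ , _ , h)) =
    inj₁ (≡.subst (λ Y → SN ⟨ _ , Y ⟩) (rename-id X)
      (h cutˡ _ _ _ _ _ _ id id (λ _ → refl) (λ _ → refl) d (Env-≺ r (node rs) cutˡ η)))

  -- Only a variable on the left can fail to be rigid, and then its value is good and settles the
  -- whole cut.
  rigid-or-SNˡ : ∀ p (t : Term l m n) {e : Term r m n} (T : Tree ⟨ t , e ⟩) →
                 Γ ⊢[ t ∶ B ], Δ → Γ ,[ e ∶ B ]⊢ Δ → Env p A (Good p A T) Γ Δ Γ′ Δ′ σ τ →
                 SN (subst σ τ ⟨ t , e ⟩) ⊎ Rigidˡ σ t
  rigid-or-SNˡ p (varˡ x) T (axˡ refl) d η = Good-cutˡ p T d η (valueˡ η x)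
  rigid-or-SNˡ p (λˡ _)   T _ _ η = inj₂ tt
  rigid-or-SNˡ p (μˡ _)   T _ _ η = inj₂ tt
  rigid-or-SNˡ p (_ ∙ˡ _) T _ _ η = inj₂ tt

  rigid-or-SNʳ : ∀ p {t : Term l m n} (e : Term r m n) (T : Tree ⟨ t , e ⟩) →
                 Γ ⊢[ t ∶ B ], Δ → Γ ,[ e ∶ B ]⊢ Δ → Env p A (Good p A T) Γ Δ Γ′ Δ′ σ τ →
                 SN (subst σ τ ⟨ t , e ⟩) ⊎ Rigidʳ τ e
  rigid-or-SNʳ p (varʳ α) T d (axʳ refl) η = Good-cutʳ p T d η (valueʳ η α)
  rigid-or-SNʳ p (λʳ _)   T _ _ η = inj₂ tt
  rigid-or-SNʳ p (μʳ _)   T _ _ η = inj₂ tt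
  rigid-or-SNʳ p (_ ∙ʳ _) T _ _ η = inj₂ tt

  -- Induction on the tree. At a cut, a good value standing as one of the two sides settles the cut;
  -- otherwise the root contracta are substituted reducts of the original cut. These need not be
  -- subterms of it, but they lie below it in `≺`.
  SN-subst : ∀ p (t : Term k m n) (T : Tree t) → Typing k Γ Δ t B →
             Env p A (Good p A T) Γ Δ Γ′ Δ′ σ τ → SN (subst σ τ t)
  SN-subst {B = B} p ⟨ t , e ⟩ (node rs) (cut d d′) η
    with rigid-or-SNˡ p t (node rs) d d′ η | rigid-or-SNʳ p e (node rs) d d′ η
  ... | inj₁ sn | _       = sn
  ... | inj₂ _  | inj₁ sn = sn
  ... | inj₂ v  | inj₂ w  =
    SN-cut (SN-subst p t (rs cutˡ) d (Env-≺ p (node rs) cutˡ η))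
           (SN-subst p e (rs cutʳ) d′ (Env-≺ p (node rs) cutʳ η))
           (SNhead-subst t e v w λ q → SN-subst {B = B} p _ (rs (red q)) (subject-reduction {A = B} q (cut d d′))
                                                (Env-≺ p (node rs) (red q) η))
  SN-subst p (varˡ x) T d η = Value-SN p T (valueˡ η x)
  SN-subst p (varʳ α) T d η = Value-SN p T (valueʳ η α)
  SN-subst p (λˡ t) (node rs) (⇒-r d) η =
    SN-λˡ (SN-subst p t (rs inλˡ) d (Env-liftˡ p (rs inλˡ) (Env-≺ p (node rs) inλˡ η)))
  SN-subst {B = B} p (μˡ s) (node rs) (act-r d) η =
    SN-μˡ (SN-subst {B = B} p s (rs inμˡ) d (Env-liftʳ p (rs inμˡ) (Env-≺ p (node rs) inμˡ η)))
  SN-subst p (e ∙ˡ t) (node rs) (minus-r d d′) η =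
    SN-∙ˡ (SN-subst p e (rs ∙ˡ₁) d′ (Env-≺ p (node rs) ∙ˡ₁ η)) (SN-subst p t (rs ∙ˡ₂) d (Env-≺ p (node rs) ∙ˡ₂ η))
  SN-subst p (λʳ e) (node rs) (minus-l d) η =
    SN-λʳ (SN-subst p e (rs inλʳ) d (Env-liftʳ p (rs inλʳ) (Env-≺ p (node rs) inλʳ η)))
  SN-subst {B = B} p (μʳ s) (node rs) (act-l d) η =
    SN-μʳ (SN-subst {B = B} p s (rs inμʳ) d (Env-liftˡ p (rs inμʳ) (Env-≺ p (node rs) inμʳ η)))
  SN-subst p (t ∙ʳ e) (node rs) (⇒-l d d′) η =
    SN-∙ʳ (SN-subst p t (rs ∙ʳ₁) d (Env-≺ p (node rs) ∙ʳ₁ η)) (SN-subst p e (rs ∙ʳ₂) d′ (Env-≺ p (node rs) ∙ʳ₂ η))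

  -- Cuts, by induction on the type

  CutSN : Type Atom → Set a
  CutSN A = ∀ m n {Γ : Context Atom m} {Δ : Context Atom n} {t e} →
            Γ ⊢[ t ∶ A ], Δ → Γ ,[ e ∶ A ]⊢ Δ → SN t → SN e → SN ⟨ t , e ⟩

  ComponentsCutSN : Type Atom → Set a
  ComponentsCutSN (atom _) = ⊤ₚ
  ComponentsCutSN (A ⇒ B)  = CutSN A × CutSN B
  ComponentsCutSN (A - B)  = CutSN A × CutSN B

  -- The contractum nests a cut at `B` in a cut at `A`. The inner one is handled first; it lies
  -- under the new binder, whence the quantification over scopes in `CutSN`. In `SNλ̄-typed` the
  -- inner cut is at `A` and the outer one at `B`.
  SNλ-typed : ∀ {t : Term l m n} {e : Term r m n} → ComponentsCutSN A →
              Γ ⊢[ t ∶ A ], Δ → Γ ,[ e ∶ A ]⊢ Δ → SN t → SN e → SNλ t e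
  SNλ-typed (hA , hB) (⇒-r d) (⇒-l {e = e} d′ d″) a b =
    hA _ _ d′ (act-l (cut d (typing-weakenˡ e d″))) (SN-inverse (_∙ʳ _) ξ-∙ʳ₁ b)
      (SN-μʳ (hB _ _ d (typing-weakenˡ e d″) (SN-inverse λˡ ξ-λˡ a) (SN-rename (SN-inverse (_ ∙ʳ_) ξ-∙ʳ₂ b))))
  SNλ-typed _ (⇒-r _)       (axʳ _)   _ _ = tt
  SNλ-typed _ (⇒-r _)       (act-l _) _ _ = tt
  SNλ-typed _ (axˡ _)       _         _ _ = tt
  SNλ-typed _ (minus-r _ _) _         _ _ = tt
  SNλ-typed _ (act-r _)     _         _ _ = tt

  SNλ̄-typed : ∀ {t : Term l m n} {e : Term r m n} → ComponentsCutSN A →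
              Γ ⊢[ t ∶ A ], Δ → Γ ,[ e ∶ A ]⊢ Δ → SN t → SN e → SNλ̄ t e
  SNλ̄-typed (hA , hB) (minus-r {t = t} d d′) (minus-l d″) a b =
    hB _ _ (act-r (cut (typing-weakenʳ t d) d″)) d′
      (SN-μˡ (hA _ _ (typing-weakenʳ t d) d″ (SN-rename (SN-inverse (_ ∙ˡ_) ξ-∙ˡ₂ a)) (SN-inverse λʳ ξ-λʳ b)))
      (SN-inverse (_∙ˡ _) ξ-∙ˡ₁ a)
  SNλ̄-typed _ (minus-r _ _) (axʳ _)   _ _ = tt
  SNλ̄-typed _ (minus-r _ _) (act-l _) _ _ = tt
  SNλ̄-typed _ (axˡ _)       _         _ _ = tt
  SNλ̄-typed _ (⇒-r _)       _         _ _ = tt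
  SNλ̄-typed _ (act-r _)     _         _ _ = tt

  -- With `p` equal to `r` the constructor `good` is impossible for an l-term, so every l-variable
  -- has a variable as its value.
  Env-r-rigid : (t : Term l m n) → {G : ∀ {m n} → Context Atom m → Context Atom n → Term r m n → Set a} →
                Env r A G Γ Δ Γ′ Δ′ σ τ → Rigidˡ σ t
  Env-r-rigid (varˡ x) η with var v ← valueˡ η x = v
  Env-r-rigid (λˡ _)   η = tt
  Env-r-rigid (μˡ _)   η = tt
  Env-r-rigid (_ ∙ˡ _) η = tt

  Env-l-rigid : (e : Term r m n) → {G : ∀ {m n} → Context Atom m → Context Atom n → Term l m n → Set a} →
                Env l A G Γ Δ Γ′ Δ′ σ τ → Rigidʳ τ e
  Env-l-rigid (varʳ α) η with var v ← valueʳ η α = v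
  Env-l-rigid (λʳ _)   η = tt
  Env-l-rigid (μʳ _)   η = tt
  Env-l-rigid (_ ∙ʳ _) η = tt

  module _ (H : ComponentsCutSN A) where

    -- The two sides have separate source scopes and substitutions, sharing only the target, since
    -- each descends through its own reducts and subterms. Each call among this lemma, `Good-substʳ`
    -- and `Good-substˡ` shrinks one of `T` and `E` and keeps the other.
    SN-cut-subst : ∀ {t : Term l m n} {e : Term r m″ n″} (T : Tree t) (E : Tree e) →
                   Γ ⊢[ t ∶ A ], Δ → Env r A (Good r A T) Γ Δ Γ′ Δ′ σ₁ τ₁ →
                   Γ₀ ,[ e ∶ A ]⊢ Δ₀ → Env l A (Good l A E) Γ₀ Δ₀ Γ′ Δ′ σ₂ τ₂ →
                   SN ⟨ subst σ₁ τ₁ t , subst σ₂ τ₂ e ⟩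

    -- Goodness at `T` asks only for cuts with some `u ≺ t`, and `SN-cut-subst` provides them at a
    -- subtree of `T`. The renaming of the substituted `e` is absorbed into the environment of `e`.
    Good-substʳ : ∀ {t : Term k m n} {e : Term r m″ n″} (T : Tree t) (E : Tree e) →
                  Γ₀ ,[ e ∶ A ]⊢ Δ₀ → Env l A (Good l A E) Γ₀ Δ₀ Γ′ Δ′ σ τ →
                  Good r A T Γ′ Δ′ (subst σ τ e)
    Good-substʳ {e = e} (node rs) E d η =
      SN-subst l e E d η ,
      (λ q → Good-substʳ (rs q) E d η) ,
      λ q _ _ _ _ σ′ τ′ ρ ξ f g d′ η′ →
        ≡.subst (λ e′ → SN ⟨ _ , e′ ⟩) (sym (rename-subst (λ _ → refl) (λ _ → refl) e))
          (SN-cut-subst (rs q) E d′ η′ d (Env-rename l E f g η))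

    Good-substˡ : ∀ {t : Term l m n} {e : Term k m″ n″} (T : Tree t) (E : Tree e) →
                  Γ ⊢[ t ∶ A ], Δ → Env r A (Good r A T) Γ Δ Γ′ Δ′ σ τ →
                  Good l A E Γ′ Δ′ (subst σ τ t)
    Good-substˡ {t = t} T (node rs) d η =
      SN-subst r t T d η ,
      (λ q → Good-substˡ T (rs q) d η) ,
      λ q _ _ _ _ σ′ τ′ ρ ξ f g d′ η′ →
        ≡.subst (λ t′ → SN ⟨ t′ , _ ⟩) (sym (rename-subst (λ _ → refl) (λ _ → refl) t))
          (SN-cut-subst T (rs q) d (Env-rename r T f g η) d′ η′)

    SN-cut-subst {t = t} {e = e} (node rs) (node rs′) d η d′ η′ =
      SN-cut snt sne record
        { snμ = SNμ-subst t (Env-r-rigid t η) (snμ-subst d)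
        ; snμ̃ = SNμ̃-subst e (Env-l-rigid e η′) (snμ̃-subst d′)
        -- For the λ-rules the environments no longer matter: the substituted sides enter only as
        -- typed, strongly normalizing terms.
        ; snλ = SNλ-typed H dt de snt sne
        ; snλ̄ = SNλ̄-typed H dt de snt sne }
      where
      snt = SN-subst r t (node rs) d η
      sne = SN-subst l e (node rs′) d′ η′
      dt = typing-subst t d (typingˡ η) (typingʳ η)
      de = typing-subst e d′ (typingˡ η′) (typingʳ η′)

      snμ-subst : ∀ {s} → _ ⊢[ t ∶ A ], _ → t ≡ μˡ s → SN (subst _ (_ ∷ᶠ _) s)
      snμ-subst {s} (act-r d₁) refl =
        -- The environment of `t` gains the substituted `e` as the value of the variable bound by
        -- `μˡ`, of type `A`; it is good for `s` by recursion on the smaller left tree.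
        SN-subst {B = A} r s (rs inμˡ) d₁
          (Env-consʳ (rs inμˡ) de (Good-substʳ (rs inμˡ) (node rs′) d′ η′) (Env-≺ r (node rs) inμˡ η))

      snμ̃-subst : ∀ {s} → _ ,[ e ∶ A ]⊢ _ → e ≡ μʳ s → SN (subst (_ ∷ᶠ _) _ s)
      snμ̃-subst {s} (act-l d₁) refl =
        SN-subst {B = A} l s (rs′ inμʳ) d₁
          (Env-consˡ (rs′ inμʳ) dt (Good-substˡ (node rs) (rs′ inμʳ) d η) (Env-≺ l (node rs′) inμʳ η′))

    components⇒CutSN : CutSN A
    components⇒CutSN _ _ {t = t} {e = e} d d′ a b =
      -- Both substitutions are taken to be identities: all their values are variables, so no
      -- goodness has to be supplied.
      ≡.subst SN (cong₂ ⟨_,_⟩ (subst-id (λ _ → refl) (λ _ → refl) t) (subst-id (λ _ → refl) (λ _ → refl) e))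
        (SN-cut-subst (SN⇒Tree a) (SN⇒Tree b) d (Env-id r (SN⇒Tree a)) d′ (Env-id l (SN⇒Tree b)))

  cutSN : ∀ A → CutSN A
  cutSN (atom _) = components⇒CutSN ttₚ
  cutSN (A ⇒ B)  = components⇒CutSN (cutSN A , cutSN B)
  cutSN (A - B)  = components⇒CutSN (cutSN A , cutSN B)

  -- From cuts to all typed terms

  typing⇒SN : (t : Term k m n) → Typing k Γ Δ t A → SN t
  typing⇒SN ⟨ t , e ⟩ (cut d d′)     = cutSN _ _ _ d d′ (typing⇒SN t d) (typing⇒SN e d′)
  typing⇒SN (varˡ x)  _              = SN-var
  typing⇒SN (λˡ t)    (⇒-r d)        = SN-λˡ (typing⇒SN t d)
  typing⇒SN {A = A} (μˡ s) (act-r d) = SN-μˡ (typing⇒SN {A = A} s d)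
  typing⇒SN (e ∙ˡ t)  (minus-r d d′) = SN-∙ˡ (typing⇒SN e d′) (typing⇒SN t d)
  typing⇒SN (varʳ α)  _              = SN-covar
  typing⇒SN (λʳ e)    (minus-l d)    = SN-λʳ (typing⇒SN e d)
  typing⇒SN {A = A} (μʳ s) (act-l d) = SN-μʳ (typing⇒SN {A = A} s d)
  typing⇒SN (t ∙ʳ e)  (⇒-l d d′)     = SN-∙ʳ (typing⇒SN t d) (typing⇒SN e d′)

theorem3p18 : {a : Level} (Atom : Set a) {k : Kind} {m n : ℕ} (t : Term k m n) → Typed Atom t → StronglyNormalizing t
theorem3p18 Atom t typed =
  descent∧acc⇒unsatisfiable {P = λ u → ∃[ f ] InfiniteDescendingSequenceFrom (flip _▷_) f u}
    -- An infinite reduction from `f 0` yields one from its reduct `f 1` by dropping the first term,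
    -- so the property descends forever, which accessibility forbids.
    (λ { (f , refl , f▷) → f 1 , f▷ 0 , f ∘ suc , refl , f▷ ∘ suc })
    (typed⇒SN t typed)
  where
  typed⇒SN : ∀ {k m n} (t : Term k m n) → Typed Atom t → SN t
  -- `Type Atom` is empty when `Atom` is, so the dummy type of a c-term is taken from the
  -- derivation, as its cut formula.
  typed⇒SN {c} s (_ , _ , cut {A = A} d d′) = typing⇒SN {A = A} s (cut d d′)
  typed⇒SN {l} t (_ , _ , _ , d) = typing⇒SN t d
  typed⇒SN {r} e (_ , _ , _ , d) = typing⇒SN e d
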